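{- Let $f\ge 1$ be an integer, let $G=(V,E)$ be a connected graph with unique node identifiers, and let $S$ be the greedy $(2f+2,2f+1)$-ruling set of $G$. Suppose that every node $v$, except for at most $f$ faulty nodes, is given the label $\zeta(v)=b(v)\circ distS(v)$, where $b(v)=1$ if $v\in S$ and $b(v)=0$ otherwise, and $distS(v)=\min_{u\in S} dist(v,u)$; each faulty node is given an empty label. Then there exists a deterministic $\mathsf{Congest}$ algorithm at the end of which every node $v$ (faulty or not) outputs its correct value $b(v)$. The algorithm runs in $O(f)$ rounds.
   Context: $dist(u,v)$ denotes the hop distance in $G$. An $(\alpha,\beta)$-ruling set is a set $S\subseteq V$ such that every two distinct nodes of $S$ are at distance at least $\alpha$, and every node of $V$ is within distance at most $\beta$ of some node of $S$. The greedy $(2f+2,2f+1)$-ruling set is constructed by iterating over the nodes in increasing order of IDs: when a node $v$ that has not been excluded is reached, it is added to $S$, and all nodes within distance $2f+1$ of $v$ are excluded (and ignored in later iterations). In the $\mathsf{Congest}$ model, nodes communicate in synchronous rounds by exchanging $O(\log n)$-bit messages along edges, where $n=|V|$. $a\circ b$ denotes concatenation. -}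

module Defs where

open import Data.Nat using (ℕ; zero; suc; _+_; _*_; _^_; _≤_; _<_; _≡ᵇ_)
open import Data.Nat.Logarithm using (⌊log₂_⌋)
open import Data.Bool using (Bool; true; false; _∧_; if_then_else_)
open import Data.Fin using (Fin)
open import Data.Fin.Subset using (Subset; _∈_; _∉_; ∣_∣)
open import Data.List using (List; []; _∷_)
open import Data.Bool.ListAction using (any)
open import Data.List.Base using (allFin)
open import Data.Maybe using (Maybe; just; nothing)
open import Data.Product using (Σ; ∃; ∃-syntax; _×_; _,_)
open import Relation.Nullary using (¬_)
open import Relation.Binary.PropositionalEquality using (_≡_)
open import Function.Bundles using (_⇔_)
open import Function.Definitions using (Injective)

record Graph (n : ℕ) : Set where
  field
    adj    : Fin n → Fin n → Bool
    sym    : ∀ u v → adj u v ≡ adj v u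
    irrefl : ∀ v → adj v v ≡ false
open Graph public

data Walk {n : ℕ} (G : Graph n) : Fin n → Fin n → ℕ → Set where
  here : ∀ {u} → Walk G u u 0
  step : ∀ {u w v k} → adj G u w ≡ true → Walk G w v k → Walk G u v (suc k)

Connected : ∀ {n} → Graph n → Set
Connected {n} G = ∀ (u v : Fin n) → ∃[ k ] Walk G u v k

Within : ∀ {n} → Graph n → Fin n → Fin n → ℕ → Set
Within G u v k = ∃[ k' ] (k' ≤ k × Walk G u v k')

IsDistToSet : ∀ {n} → Graph n → (Fin n → Bool) → Fin n → ℕ → Set
IsDistToSet {n} G S v d =
  (∃[ u ] (S u ≡ true × Walk G v u d)) ×
  (∀ (u : Fin n) k → S u ≡ true → Walk G v u k → d ≤ k)

-- S is the greedy (2f+2,2f+1)-ruling set w.r.t. the identifiers `ident`: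
-- scanning nodes by increasing ID, v joins S iff it has not been excluded,
-- i.e. iff no node of S with a smaller ID is within distance 2f+1 of v.
-- (This determines S uniquely by induction on IDs, since IDs are distinct.)
IsGreedyRulingSet : ∀ {n} → ℕ → Graph n → (Fin n → ℕ) → (Fin n → Bool) → Set
IsGreedyRulingSet {n} f G ident S =
  ∀ (v : Fin n) →
    (S v ≡ true) ⇔
    (¬ (∃[ u ] (S u ≡ true × ident u < ident v × Within G u v (suc (2 * f)))))

-- Deterministic synchronous message passing (Congest) algorithms.
-- A node initially knows n, its own ID, its input label, and the IDs of
-- its neighbours (given as an indicator on ℕ).  In each round it sends
-- to each neighbour (addressed by ID) a message (a natural number), then
-- updates its state from the messages received (indexed by sender ID).
-- After `rounds` rounds every node outputs a bit.

Label : Set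
Label = Maybe (Bool × ℕ)

record Algorithm : Set₁ where
  field
    State  : Set
    init   : ℕ → ℕ → Label → (ℕ → Bool) → State
    send   : State → ℕ → ℕ
    recv   : State → (ℕ → Maybe ℕ) → State
    output : State → Bool
    rounds : ℕ
open Algorithm public

pick : ∀ {n} {A : Set} → List (Fin n) → (Fin n → Bool) → (Fin n → A) → Maybe A
pick []       p g = nothing
pick (u ∷ us) p g = if p u then just (g u) else pick us p g

neighbourIds : ∀ {n} → Graph n → (Fin n → ℕ) → Fin n → ℕ → Bool
neighbourIds {n} G ident v k = any (λ u → adj G v u ∧ (ident u ≡ᵇ k)) (allFin n)

exec : (A : Algorithm) → ∀ {n} → Graph n → (Fin n → ℕ) → (Fin n → Label) →
       ℕ → Fin n → State A
exec A {n} G ident ζ zero    v = init A n (ident v) (ζ v) (neighbourIds G ident v)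
exec A {n} G ident ζ (suc t) v =
  recv A (exec A G ident ζ t v)
    (λ k → pick (allFin n) (λ u → adj G v u ∧ (ident u ≡ᵇ k))
                 (λ u → send A (exec A G ident ζ t u) (ident v)))

Bandwidth : (A : Algorithm) → ∀ {n} → Graph n → (Fin n → ℕ) → (Fin n → Label) →
            ℕ → Set
Bandwidth A {n} G ident ζ B =
  ∀ t (u v : Fin n) → t < rounds A → adj G u v ≡ true →
    send A (exec A G ident ζ t u) (ident v) < 2 ^ B

congestBits : ℕ → ℕ → ℕ
congestBits C n = C * (suc ⌊log₂ n ⌋)

{-# OPTIONS --safe #-}
module Submission where

-- A faulty node v that belongs to S sees only labels distS(w) ≤ dist(v,w) on the labelled nodes w within
-- distance f; call any faulty node with this property a candidate.  A candidate v outside S shares each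
-- such w with a member s of S that is at distance distS(w) ≤ dist(v,w) from w.  If s is labelled, w can
-- tell.  If s is faulty, then s has a smaller ID than v, because otherwise too many nodes would be faulty
-- (see `conflict`).  Hence v is in S iff no labelled w within distance f has, within distance distS(w), a
-- labelled member of S or a candidate with an ID below that of v.  Floods of minima decide this in 3f
-- rounds, with one number per message.

open import Defs renaming (sym to adj-sym)
open import Data.Nat
open import Data.Nat.Logarithm using (⌊log₂_⌋; ⌊log₂⌋-mono-≤; ⌊log₂[2^n]⌋≡n)
open import Data.Nat.Properties
open import Data.Nat.Tactic.RingSolver using (solve-∀)
open import Data.Bool using (Bool; true; false; _∧_; if_then_else_)
open import Data.Bool.Properties as Bool using (T-≡)
open import Data.Empty using (⊥; ⊥-elim)
open import Data.Fin using (Fin)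
open import Data.Fin.Properties as Fin using (any?)
open import Data.Fin.Subset using (Subset; _∈_; _∉_; ∣_∣; ⊤)
open import Data.Fin.Subset.Properties
  using (_∈?_; ∈⊤; ∣⊤∣≡n; p⊆q⇒∣p∣≤∣q∣; x∈p⇒∣p-x∣<∣p∣; x∈p∧x≢y⇒x∈p-y)
open import Data.List using (List; []; _∷_; _++_; length; applyUpTo; allFin)
open import Data.List.Membership.Propositional using () renaming (_∈_ to _∈ˡ_)
open import Data.List.Membership.Propositional.Properties using (∈-applyUpTo⁻; ∈-allFin)
open import Data.List.Properties using (length-++; length-applyUpTo)
open import Data.List.Relation.Unary.All as All using (All; []; _∷_)
import Data.List.Relation.Unary.All.Properties as All
open import Data.List.Relation.Unary.AllPairs using ([]; _∷_)
open import Data.List.Relation.Unary.Any using (here; there)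
open import Data.List.Relation.Unary.Unique.Propositional using (Unique)
import Data.List.Relation.Unary.Unique.Propositional.Properties as Unique
open import Data.Maybe using (Maybe; just; nothing)
open import Data.Maybe.Properties using (just-injective)
open import Data.Product using (Σ; ∃-syntax; _×_; _,_; proj₁; proj₂)
open import Data.Sum using (_⊎_; inj₁; inj₂)
open import Function using (_∘_)
open import Function.Bundles using (Equivalence)
open import Function.Definitions using (Injective)
open import Level using (0ℓ)
open import Relation.Binary.Definitions using (tri<; tri≈; tri>)
open import Relation.Binary.PropositionalEquality
open import Relation.Nullary using (¬_; Dec; yes; no; contradiction)
open import Relation.Nullary.Decidable
  using (does; ¬?; _×-dec_; _⊎-dec_; map′; dec-true; dec-false; decidable-stable)
open import Relation.Unary using (Pred; Decidable)

-- Extremal witnesses and counting of distinct elements.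

least : {P : Pred ℕ 0ℓ} → Decidable P → ∀ m → P m →
        ∃[ k ] (k ≤ m × P k × (∀ {j} → j < k → ¬ P j))
least P? zero p = 0 , z≤n , p , λ ()
least P? (suc m) p with P? 0
... | yes p₀ = 0 , z≤n , p₀ , λ ()
... | no ¬p₀ with least (P? ∘ suc) m p
... | k , k≤m , pk , below =
  suc k , s≤s k≤m , pk , λ { {zero} _ → ¬p₀ ; {suc j} (s≤s j<k) → below j<k }

greatest : {P : Pred ℕ 0ℓ} → Decidable P → ∀ m → P 0 →
           ∃[ e ] (e < suc m × P e × (∀ {j} → e < j → j < suc m → ¬ P j))
greatest P? zero p₀ = 0 , z<s , p₀ , λ { 0<j (s≤s j≤0) → contradiction (<-≤-trans 0<j j≤0) λ () }
greatest P? (suc m) p₀ with P? (suc m)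
... | yes p = suc m , ≤-refl , p , λ e<j j<2+m → contradiction (<-≤-trans e<j (s≤s⁻¹ j<2+m)) (<-irrefl refl)
... | no ¬p with greatest P? m p₀
... | e , e<1+m , pe , above = e , m<n⇒m<1+n e<1+m , pe , above′
  where
  above′ : ∀ {j} → e < j → j < suc (suc m) → ¬ _
  above′ {j} e<j j<2+m with m≤n⇒m<n∨m≡n (s≤s⁻¹ j<2+m)
  ... | inj₁ j<1+m = above e<j j<1+m
  ... | inj₂ refl = ¬p

unique⇒length≤∣∣ : ∀ {n} {p : Subset n} {xs} → Unique xs → All (_∈ p) xs → length xs ≤ ∣ p ∣
unique⇒length≤∣∣ [] [] = z≤n
unique⇒length≤∣∣ {p = p} (x∉xs ∷ u) (x∈p ∷ xs∈p) =
  ≤-<-trans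
    (unique⇒length≤∣∣ u (All.zipWith (λ (x≢y , y∈p) → x∈p∧x≢y⇒x∈p-y y∈p (x≢y ∘ sym)) (x∉xs , xs∈p)))
    (x∈p⇒∣p-x∣<∣p∣ x∈p)

-- Walks and the layers of shortest walks.

module Walks {n} (G : Graph n) where

  infixr 5 _◅◅_
  _◅◅_ : ∀ {u v w k l} → Walk G u v k → Walk G v w l → Walk G u w (k + l)
  here ◅◅ q = q
  step e p ◅◅ q = step e (p ◅◅ q)

  snoc : ∀ {u v w k} → Walk G u v k → adj G v w ≡ true → Walk G u w (suc k)
  snoc here e = step e here
  snoc (step e′ p) e = step e′ (snoc p e)

  reverse : ∀ {u v k} → Walk G u v k → Walk G v u k
  reverse here = here
  reverse (step {u} {w} e p) = snoc (reverse p) (trans (adj-sym G w u) e)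

  walk? : ∀ k u v → Dec (Walk G u v k)
  walk? zero u v = map′ (λ { refl → here }) (λ { here → refl }) (u Fin.≟ v)
  walk? (suc k) u v =
    map′ (λ (_ , e , p) → step e p) (λ { (step e p) → _ , e , p })
         (any? λ w → (adj G u w Bool.≟ true) ×-dec walk? k w v)

  Shortest : Fin n → Fin n → ℕ → Set
  Shortest u v k = ∀ {m} → Walk G u v m → k ≤ m

  shortest : ∀ {u v k} → Walk G u v k → ∃[ m ] (m ≤ k × Walk G u v m × Shortest u v m)
  shortest {u} {v} p with least (λ k → walk? k u v) _ p
  ... | m , m≤k , q , below = m , m≤k , q , λ r → ≮⇒≥ λ l<m → below l<m r

  at : ∀ {u v k} → Walk G u v k → ℕ → Fin n
  at {u} _ zero = u
  at {u} here (suc _) = u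
  at (step _ p) (suc j) = at p j

  at-end : ∀ {u v k} (p : Walk G u v k) → at p k ≡ v
  at-end here = refl
  at-end (step _ p) = at-end p

  segment : ∀ {u v k} (p : Walk G u v k) i m → i + m ≤ k → Walk G (at p i) (at p (i + m)) m
  segment p zero zero _ = here
  segment (step e p) zero (suc m) (s≤s m≤k) = step e (segment p zero m m≤k)
  segment here (suc i) m ()
  segment (step e p) (suc i) m (s≤s le) = segment p i m le

  segment-≤ : ∀ {u v k} (p : Walk G u v k) {i j} → i ≤ j → j ≤ k → Walk G (at p i) (at p j) (j ∸ i)
  segment-≤ p {i} {j} i≤j j≤k =
    subst (λ x → Walk G (at p i) (at p x) (j ∸ i)) (m+[n∸m]≡n i≤j)
          (segment p i (j ∸ i) (subst (_≤ _) (sym (m+[n∸m]≡n i≤j)) j≤k))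

  prefix : ∀ {u v k} (p : Walk G u v k) {i} → i ≤ k → Walk G u (at p i) i
  prefix p {i} = segment p 0 i

  suffix : ∀ {u v k} (p : Walk G u v k) {i} → i ≤ k → Walk G (at p i) v (k ∸ i)
  suffix {k = k} p {i} i≤k = subst (λ x → Walk G (at p i) x (k ∸ i)) (at-end p) (segment-≤ p i≤k ≤-refl)

  -- A shorter walk to `at p i`, continued along `p`, would undercut `p`.
  prefix-shortest : ∀ {u v k} (p : Walk G u v k) → Shortest u v k →
                    ∀ {i} → i ≤ k → Shortest u (at p i) i
  prefix-shortest {k = k} p geo {i} i≤k {m} q =
    +-cancelʳ-≤ (k ∸ i) i m (subst (_≤ m + (k ∸ i)) (sym (m+[n∸m]≡n i≤k)) (geo (q ◅◅ suffix p i≤k)))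

  -- On a shortest walk from `u`, the index of a node is its distance from `u`.
  same-layer : ∀ {u v w k l} (p : Walk G u v k) (q : Walk G u w l) →
               Shortest u v k → Shortest u w l →
               ∀ {i j} → i ≤ k → j ≤ l → at p i ≡ at q j → i ≡ j
  same-layer {u} p q geo-p geo-q i≤k j≤l eq =
    ≤-antisym (prefix-shortest p geo-p i≤k (subst (λ x → Walk G u x _) (sym eq) (prefix q j≤l)))
              (prefix-shortest q geo-q j≤l (subst (λ x → Walk G u x _) eq (prefix p i≤k)))

  interval-unique : ∀ {u v k} (p : Walk G u v k) → Shortest u v k →
                    ∀ a m → a + m ≤ suc k → Unique (applyUpTo (λ j → at p (a + j)) m)
  interval-unique {k = k} p geo a m le = Unique.applyUpTo⁺₁ _ m λ {i} {j} i<j j<m eq →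
    <-irrefl (+-cancelˡ-≡ a i j (same-layer p p geo geo (inside (<-trans i<j j<m)) (inside j<m) eq)) i<j
    where
    inside : ∀ {i} → i < m → a + i ≤ k
    inside {i} i<m = s≤s⁻¹ (≤-trans (+-monoʳ-< a i<m) le)

  -- Shortest walks repeat no node. This limits how long one can stay among faulty nodes and, with
  -- `F = ⊤`, its whole length.
  shortest-within : ∀ {u v k} (p : Walk G u v k) → Shortest u v k →
                    ∀ (F : Subset n) {m} → m ≤ suc k → (∀ {j} → j < m → at p j ∈ F) → m ≤ ∣ F ∣
  shortest-within p geo F {m} m≤1+k inF =
    subst (_≤ ∣ F ∣) (length-applyUpTo (at p) m)
      (unique⇒length≤∣∣ (interval-unique p geo 0 m m≤1+k) (All.applyUpTo⁺₁ (at p) m inF))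

  -- If e is the last common index, the detour through it has (a + 1 ∸ e) + (b + 1 ∸ e) steps, while
  -- the two initial parts together consist of a + b + 1 ∸ e nodes.
  fork : ∀ {u v w k l} (p : Walk G u v k) (q : Walk G u w l) → Shortest u v k → Shortest u w l →
         ∀ {a b} → a < k → b < l →
         ∃[ zs ] (Unique zs ×
                  All (λ z → (∃[ j ] (j < suc a × z ≡ at p j)) ⊎ (∃[ j ] (j < suc b × z ≡ at q j))) zs ×
                  (∃[ m ] (Walk G (at p (suc a)) (at q (suc b)) m × a + b + m ≡ 2 * length zs)))
  fork p q geo-p geo-q {a} {b} a<k b<l with greatest (λ j → at p j Fin.≟ at q j) (a ⊓ b) refl
  ... | e , e< , meet , apart =
    trunk ++ branch , unique , All.++⁺ on-p on-q , suc a ∸ e + (suc b ∸ e) , detour , balance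
    where
    e≤a : e ≤ a
    e≤a = ≤-trans (s≤s⁻¹ e<) (m⊓n≤m a b)

    e≤b : e ≤ b
    e≤b = ≤-trans (s≤s⁻¹ e<) (m⊓n≤n a b)

    trunk branch : List (Fin n)
    trunk = applyUpTo (at p) (suc a)
    branch = applyUpTo (λ j → at q (suc e + j)) (b ∸ e)

    branch-end : suc e + (b ∸ e) ≡ suc b
    branch-end = cong suc (m+[n∸m]≡n e≤b)

    inside-branch : ∀ {j} → j < b ∸ e → suc e + j < suc b
    inside-branch {j} j< = subst (suc e + j <_) branch-end (+-monoʳ-< (suc e) j<)

    on-p = All.applyUpTo⁺₁ (at p) (suc a) λ j<1+a → inj₁ (_ , j<1+a , refl)
    on-q = All.applyUpTo⁺₁ (λ j → at q (suc e + j)) (b ∸ e) λ j< → inj₂ (_ , inside-branch j< , refl)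

    -- By `same-layer`, a shared node would sit at a common index beyond `e`.
    disjoint : ∀ {z} → ∃[ i ] (i < suc a × z ≡ at p i) → ¬ (∃[ j ] (j < b ∸ e × z ≡ at q (suc e + j)))
    disjoint (i , i<1+a , refl) (j , j< , eq)
      with same-layer p q geo-p geo-q (<⇒≤ (<-≤-trans i<1+a a<k)) (<⇒≤ (<-≤-trans (inside-branch j<) b<l)) eq
    ... | refl = apart (s≤s (m≤m+n e j)) (s≤s (⊓-glb (s≤s⁻¹ i<1+a) (s≤s⁻¹ (inside-branch j<)))) eq

    unique : Unique (trunk ++ branch)
    unique = Unique.++⁺ (interval-unique p geo-p 0 (suc a) (m≤n⇒m≤1+n a<k))
      (interval-unique q geo-q (suc e) (b ∸ e) (≤-trans (≤-reflexive branch-end) (m≤n⇒m≤1+n b<l)))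
      λ (z∈trunk , z∈branch) →
        disjoint (∈-applyUpTo⁻ (at p) z∈trunk) (∈-applyUpTo⁻ (λ j → at q (suc e + j)) z∈branch)

    detour : Walk G (at p (suc a)) (at q (suc b)) (suc a ∸ e + (suc b ∸ e))
    detour = reverse (segment-≤ p (m≤n⇒m≤1+n e≤a) a<k)
      ◅◅ subst (λ z → Walk G z (at q (suc b)) (suc b ∸ e)) (sym meet) (segment-≤ q (m≤n⇒m≤1+n e≤b) b<l)

    balance : a + b + (suc a ∸ e + (suc b ∸ e)) ≡ 2 * length (trunk ++ branch)
    balance = begin
      a + b + (suc a ∸ e + (suc b ∸ e))  ≡⟨ cong (a + b +_) (cong₂ _+_ (+-∸-assoc 1 e≤a) (+-∸-assoc 1 e≤b)) ⟩
      a + b + (suc a′ + suc b′)          ≡⟨ cong (_+ (suc a′ + suc b′)) (cong₂ _+_ a≡ (sym (m+[n∸m]≡n e≤b))) ⟩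
      e + a′ + (e + b′) + (suc a′ + suc b′)  ≡⟨ arith e a′ b′ ⟩
      2 * (suc (e + a′) + b′)            ≡⟨ cong (λ x → 2 * (suc x + b′)) (sym a≡) ⟩
      2 * (suc a + b′)                   ≡⟨ cong (2 *_) (sym (trans (length-++ trunk)
                                              (cong₂ _+_ (length-applyUpTo (at p) (suc a)) (length-applyUpTo _ b′)))) ⟩
      2 * length (trunk ++ branch)       ∎
      where
      open ≡-Reasoning
      a′ b′ : ℕ
      a′ = a ∸ e
      b′ = b ∸ e
      a≡ : a ≡ e + a′
      a≡ = sym (m+[n∸m]≡n e≤a)
      arith : ∀ e a b → e + a + (e + b) + (suc a + suc b) ≡ 2 * (suc (e + a) + b)
      arith = solve-∀

-- Greedy ruling sets with few faulty nodes.

module GreedyFaults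
  {n} (f : ℕ) (G : Graph n) (ident : Fin n → ℕ) (ident-inj : Injective _≡_ _≡_ ident)
  (S : Fin n → Bool) (greedy : IsGreedyRulingSet f G ident S)
  where

  open Walks G

  -- Otherwise the node with the smaller ID would have excluded the other.
  separated : ∀ {u v k} → S u ≡ true → S v ≡ true → Walk G u v k → k ≤ suc (2 * f) → u ≡ v
  separated {u} {v} Su Sv p k≤ with <-cmp (ident u) (ident v)
  ... | tri< lt _ _ = ⊥-elim (Equivalence.to (greedy v) Sv (u , Su , lt , _ , k≤ , p))
  ... | tri≈ _ eq _ = ident-inj eq
  ... | tri> _ _ gt = ⊥-elim (Equivalence.to (greedy u) Su (v , Sv , gt , _ , k≤ , reverse p))

  +-within : ∀ {a b} → a ≤ f → b ≤ f → a + b ≤ suc (2 * f)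
  +-within a≤f b≤f = m≤n⇒m≤1+n (+-mono-≤ a≤f (≤-trans b≤f (m≤m+n f 0)))

  module Labels (F : Subset n) (∣F∣≤f : ∣ F ∣ ≤ f)
                (ℓ : Fin n → ℕ) (ℓ-dist : ∀ {v} → v ∉ F → IsDistToSet G S v (ℓ v)) where

    -- The test that every member of `S` passes; being faulty is kept as a separate hypothesis.
    Candidate : Fin n → Set
    Candidate v = ∀ {w k} → w ∉ F → Walk G v w k → k ≤ f → ℓ w ≤ k

    member⇒candidate : ∀ {v} → S v ≡ true → Candidate v
    member⇒candidate Sv w∉F p _ = proj₂ (ℓ-dist w∉F) _ _ Sv (reverse p)

    -- Suppose that v has the smaller ID, so that some t ∈ S with a still smaller ID excludes it.  Let x
    -- and y be the first nodes (not faulty, or y = t) on shortest paths from v to u and from v to t.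
    -- Since v is a candidate, members of S are as close to x and to y as v is; these are s for x, and
    -- some r for y, which differs from s because s is too far from t.  But s and r are at least 2f + 2
    -- apart, so that the paths from v to x and y are too long to be faulty altogether.
    conflict : ∀ {s v u k} → S s ≡ true → s ∈ F → v ∈ F → Candidate v → s ≢ v →
               u ∉ F → Walk G v u k → k ≤ f → Walk G u s (ℓ u) → ident s < ident v
    conflict {s} {v} {u} Ss s∈F v∈F cand s≢v u∉F v⇝u k≤f u⇝s with <-cmp (ident s) (ident v)
    ... | tri< lt _ _ = lt
    ... | tri≈ _ eq _ = contradiction (ident-inj eq) s≢v
    ... | tri> _ _ v<s = ⊥-elim (¬Sv (Equivalence.from (greedy v) not-excluded))
      where
      ¬Sv : S v ≢ true
      ¬Sv Sv = s≢v (separated Ss Sv (reverse u⇝s ◅◅ reverse v⇝u)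
                     (≤-trans (+-monoˡ-≤ _ (cand u∉F v⇝u k≤f)) (+-within k≤f k≤f)))

      not-excluded : ¬ (∃[ t ] (S t ≡ true × ident t < ident v × Within G t v (suc (2 * f))))
      not-excluded (t , St , t<v , k₀ , k₀≤ , t⇝v)
        with shortest v⇝u | shortest (reverse t⇝v)
      ... | d , d≤k , p , geo-p | l , l≤k₀ , q , geo-q
        with least (λ j → ¬? (at p j ∈? F)) d (λ d∈F → u∉F (subst (_∈ F) (at-end p) d∈F))
           | least (λ j → ¬? (at q j ∈? F) ⊎-dec (j ≟ l)) l (inj₂ refl)
      ... | zero , _ , v∉F , _ | _ = v∉F v∈F
      ... | suc _ , _ | zero , _ , inj₁ v∉F , _ = v∉F v∈F
      ... | suc _ , _ | zero , _ , inj₂ refl , _ =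
        contradiction (subst (λ x → ident x < ident v) (sym (at-end q)) t<v) (<-irrefl refl)
      ... | suc a , a<d , x∉F , p-faulty | suc b , b<l , y-end , q-faulty = final
        where
        l≤ : l ≤ suc (2 * f)
        l≤ = ≤-trans l≤k₀ k₀≤

        d≤f : d ≤ f
        d≤f = ≤-trans d≤k k≤f

        s≢t : s ≢ t
        s≢t refl = <-asym v<s t<v

        x y : Fin n
        x = at p (suc a)
        y = at q (suc b)

        p∈F : ∀ {j} → j < suc a → at p j ∈ F
        p∈F j<1+a = decidable-stable (_ ∈? F) (p-faulty j<1+a)

        q∈F : ∀ {j} → j < suc b → at q j ∈ F
        q∈F j<1+b = decidable-stable (_ ∈? F) (q-faulty j<1+b ∘ inj₁)

        -- Brings `y` into the range of `cand`, although `q` itself may have up to `2 * f + 1`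
        -- steps.
        1+b≤f : suc b ≤ f
        1+b≤f = ≤-trans (shortest-within q geo-q F (m≤n⇒m≤1+n b<l) q∈F) ∣F∣≤f

        near-y : y ∉ F ⊎ suc b ≡ l → ∃[ r ] ∃[ m ] (S r ≡ true × Walk G y r m × m ≤ suc b)
        near-y (inj₁ y∉F) =
          let (r , Sr , y⇝r) , _ = ℓ-dist y∉F in r , ℓ y , Sr , y⇝r , cand y∉F (prefix q b<l) 1+b≤f
        near-y (inj₂ 1+b≡l) =
          t , 0 , St , subst (λ z → Walk G y z 0) (trans (cong (at q) 1+b≡l) (at-end q)) here , z≤n

        -- Continued along `q` to `t`, such a walk would have at most `l` steps and force `s ≡ t`.
        q-avoids-s : ∀ {j m} → j ≤ l → m ≤ j → ¬ Walk G (at q j) s m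
        q-avoids-s {j} j≤l m≤j j⇝s = s≢t (separated Ss St (reverse j⇝s ◅◅ suffix q j≤l)
          (≤-trans (≤-trans (+-monoˡ-≤ _ m≤j) (≤-reflexive (m+[n∸m]≡n j≤l))) l≤))

        -- The member closest to `x` must be `s`: as `v` is a candidate, the walk from `s` through
        -- `u` and `x` to that member has at most `2 * d` steps.
        near-x : Walk G x s (ℓ x)
        near-x with ℓ-dist x∉F
        ... | (r , Sr , x⇝r) , _ =
          subst (λ z → Walk G x z (ℓ x))
            (sym (separated Ss Sr (reverse u⇝s ◅◅ reverse (suffix p a<d) ◅◅ x⇝r)
              (≤-trans (+-mono-≤ (cand u∉F p d≤f)
                         (≤-trans (+-monoʳ-≤ (d ∸ suc a) (cand x∉F (prefix p a<d) (≤-trans a<d d≤f)))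
                                  (≤-reflexive (m∸n+n≡m a<d))))
                       (+-within d≤f d≤f))))
            x⇝r

        ℓx≤ : ℓ x ≤ suc a
        ℓx≤ = cand x∉F (prefix p a<d) (≤-trans a<d d≤f)

        final : ⊥
        final with near-y y-end | fork p q geo-p geo-q a<d b<l
        ... | r , m , Sr , y⇝r , m≤1+b | zs , unique , on-p-or-q , m′ , x⇝y , 2*length = separate
          where
          s⇝r : Walk G s r (ℓ x + (m′ + m))
          s⇝r = reverse near-x ◅◅ x⇝y ◅◅ y⇝r

          s≢r : s ≢ r
          s≢r refl = q-avoids-s b<l m≤1+b y⇝r

          zs∈F : All (_∈ F) zs
          zs∈F = All.map (λ { (inj₁ (j , j≤a , refl)) → p∈F j≤a ; (inj₂ (j , j≤b , refl)) → q∈F j≤b }) on-p-or-q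

          -- Used with `c = 0` if `ℓ x ≤ a`, and with `c = 1` if `ℓ x` is `suc a`.
          s⇝r-length : ∀ {c} → ℓ x ≤ c + a → ℓ x + (m′ + m) ≤ suc c + 2 * length zs
          s⇝r-length {c} ℓx≤ = begin
            ℓ x + (m′ + m)            ≤⟨ +-mono-≤ ℓx≤ (+-monoʳ-≤ m′ m≤1+b) ⟩
            c + a + (m′ + suc b)      ≡⟨ rearrange c a b m′ ⟩
            suc c + (a + b + m′)      ≡⟨ cong (suc c +_) 2*length ⟩
            suc c + 2 * length zs     ∎
            where
            open ≤-Reasoning
            rearrange : ∀ c a b m → c + a + (m + suc b) ≡ suc c + (a + b + m)
            rearrange = solve-∀

          separate : ⊥
          separate with m≤n⇒m<n∨m≡n ℓx≤
          ... | inj₁ ℓx<1+a = s≢r (separated Ss Sr s⇝r (≤-trans (s⇝r-length {0} (s≤s⁻¹ ℓx<1+a))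
            (s≤s (*-monoʳ-≤ 2 (≤-trans (unique⇒length≤∣∣ unique zs∈F) ∣F∣≤f)))))
          -- The additional step is paid for by `s`, a further faulty node outside `zs`: now
          -- `length zs + 1 ≤ f`.
          ... | inj₂ ℓx≡1+a = s≢r (separated Ss Sr s⇝r (≤-trans (s⇝r-length {1} ℓx≤)
            (≤-trans (≤-reflexive (sym (*-suc 2 (length zs))))
              (m≤n⇒m≤1+n (*-monoʳ-≤ 2 (≤-trans
                (unique⇒length≤∣∣ (All.map s-fresh on-p-or-q ∷ unique) (s∈F ∷ zs∈F)) ∣F∣≤f))))))
            where
            s-fresh : ∀ {z} → (∃[ j ] (j < suc a × z ≡ at p j)) ⊎ (∃[ j ] (j < suc b × z ≡ at q j)) → s ≢ z
            s-fresh (inj₂ (j , j<1+b , refl)) refl =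
              q-avoids-s (<⇒≤ (<-≤-trans j<1+b b<l)) z≤n here
            s-fresh (inj₁ (zero , _ , refl)) refl = s≢v refl
            -- From this index, `s` would be within `a ∸ j` of `x`, against `ℓ x ≡ suc a`.
            s-fresh (inj₁ (suc j , 1+j<1+a , refl)) refl = 1+n≰n (≤-trans (≤-reflexive (sym ℓx≡1+a))
              (≤-trans (proj₂ (ℓ-dist x∉F) _ _ Ss (reverse (segment-≤ p (<⇒≤ 1+j<1+a) a<d))) (m∸n≤m a j)))

-- Minima over received messages.

offer : ℕ → Maybe ℕ → ℕ → ℕ
offer c nothing y = y
offer c (just m) y = (m + c) ⊓ y

-- A Bellman-Ford update. The inbox is a function on all of `ℕ`, so it is scanned up to a bound `k`
-- on the IDs.
relax : ℕ → ℕ → (ℕ → Maybe ℕ) → ℕ → ℕ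
relax c zero msgs x = x
relax c (suc k) msgs x = offer c (msgs k) (relax c k msgs x)

-- Inboxes are functions; comparing them pointwise avoids function extensionality.
relax-cong : ∀ c k {msgs msgs′} → (∀ j → msgs j ≡ msgs′ j) → ∀ x → relax c k msgs x ≡ relax c k msgs′ x
relax-cong c zero eq x = refl
relax-cong c (suc k) eq x = cong₂ (offer c) (eq k) (relax-cong c k eq x)

offer-≤ : ∀ c mm y → offer c mm y ≤ y
offer-≤ c nothing y = ≤-refl
offer-≤ c (just m) y = m⊓n≤n (m + c) y

relax-≤ : ∀ c k msgs x → relax c k msgs x ≤ x
relax-≤ c zero msgs x = ≤-refl
relax-≤ c (suc k) msgs x = ≤-trans (offer-≤ c (msgs k) _) (relax-≤ c k msgs x)

relax-≤-msg : ∀ c k msgs x {j m} → j < k → msgs j ≡ just m → relax c k msgs x ≤ m + c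
relax-≤-msg c (suc k) msgs x {j} {m} j<1+k eq with m≤n⇒m<n∨m≡n (s≤s⁻¹ j<1+k)
... | inj₁ j<k = ≤-trans (offer-≤ c (msgs k) _) (relax-≤-msg c k msgs x j<k eq)
... | inj₂ refl rewrite eq = m⊓n≤m (m + c) _

relax-sel : ∀ c k msgs x →
            relax c k msgs x ≡ x ⊎ (∃[ j ] ∃[ m ] (msgs j ≡ just m × relax c k msgs x ≡ m + c))
relax-sel c zero msgs x = inj₁ refl
relax-sel c (suc k) msgs x with msgs k in eq
... | nothing = relax-sel c k msgs x
... | just m with ⊓-sel (m + c) (relax c k msgs x)
...   | inj₁ is-m = inj₂ (k , m , eq , is-m)
...   | inj₂ is-rest with relax-sel c k msgs x
...     | inj₁ is-x = inj₁ (trans is-rest is-x)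
...     | inj₂ (j , m′ , eq′ , is-m′) = inj₂ (j , m′ , eq′ , trans is-rest is-m′)

module _ {n} {A : Set} {p : Fin n → Bool} where

  pick-cong : ∀ {g h : Fin n → A} us → (∀ u → g u ≡ h u) → pick us p g ≡ pick us p h
  pick-cong [] eq = refl
  pick-cong (u ∷ us) eq with p u
  ... | true = cong just (eq u)
  ... | false = pick-cong us eq

  pick-just : ∀ {g : Fin n → A} us {a} → pick us p g ≡ just a → ∃[ u ] (p u ≡ true × g u ≡ a)
  pick-just (u ∷ us) eq with p u in pu
  ... | true = u , pu , just-injective eq
  ... | false = pick-just us eq

  pick-unique : ∀ {g : Fin n → A} {us u} → u ∈ˡ us → p u ≡ true → (∀ {v} → p v ≡ true → v ≡ u) →
                pick us p g ≡ just (g u)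
  pick-unique {g = g} {us = v ∷ us} u∈ pu only with p v in pv | u∈
  ... | true | _ = cong (just ∘ g) (only pv)
  ... | false | here refl = contradiction (trans (sym pv) pu) λ ()
  ... | false | there u∈us = pick-unique u∈us pu only

-- Algorithms built from successive floods of minima.

record Info : Set where
  constructor mkInfo
  field
    size self : ℕ
    label : Label
open Info

-- A node reads off the flooded value after min(f , deadline) rounds of each stage, where f = 1 + f′;
-- the readings of the completed stages are kept, the latest one first.
module Staged (κ f′ : ℕ)
  (cost : ℕ → List ℕ → ℕ) (seed deadline : Info → List ℕ → ℕ) (verdict : Info → List ℕ → Bool)
  where

  record Node : Set where
    constructor mkNode
    field
      info : Info
      past : List ℕ
      remaining value clock reading : ℕ
  open Node

  start : Info → List ℕ → Node
  start i past = mkNode i past f′ (seed i past) (deadline i past) (seed i past)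

  latch : ℕ → ℕ → ℕ → ℕ
  latch zero y x = y
  latch (suc _) y x = x

  -- Invariant of the reading: `g t` is the flooded value after `t` rounds, `w` the deadline and
  -- `w ∸ t` the clock.
  latch-⊓ : ∀ (g : ℕ → ℕ) t w → latch (w ∸ t) (g (t ⊓ w)) (g (suc t)) ≡ g (suc t ⊓ w)
  latch-⊓ g zero zero = refl
  latch-⊓ g zero (suc w) = refl
  latch-⊓ g (suc t) zero = refl
  latch-⊓ g (suc t) (suc w) = latch-⊓ (g ∘ suc) t w

  advance : Node → ℕ → Node
  -- The round that finds none remaining still performs an update of its stage, so a stage lasts
  -- `suc f′` rounds.
  advance (mkNode i past zero _ w y) x = start i (latch w y x ∷ past)
  advance (mkNode i past (suc r) _ w y) x = mkNode i past r x (pred w) (latch w y x)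

  relaxed : Node → (ℕ → Maybe ℕ) → ℕ
  relaxed s msgs = relax (cost (size (info s)) (past s)) (size (info s) ^ κ) msgs (value s)

  algorithm : Algorithm
  algorithm = record
    { State = Node
    ; init = λ n i l _ → start (mkInfo n i l) []
    ; send = λ s _ → value s
    ; recv = λ s msgs → advance s (relaxed s msgs)
    ; output = λ s → verdict (info s) (past s)
    ; rounds = 3 * suc f′
    }

  -- Executions as floods.

  module Run {n} (G : Graph n) (ident : Fin n → ℕ) (ζ : Fin n → Label)
             (ident-inj : Injective _≡_ _≡_ ident) (ident< : ∀ v → ident v < n ^ κ) where

    open Walks G

    info-of : Fin n → Info
    info-of v = mkInfo n (ident v) (ζ v)

    run : ℕ → Fin n → Node
    run = exec algorithm G ident ζ

    inbox : (Fin n → ℕ) → Fin n → ℕ → Maybe ℕ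
    inbox g v k = pick (allFin n) (λ u → adj G v u ∧ (ident u ≡ᵇ k)) g

    flood : ℕ → (Fin n → ℕ) → ℕ → Fin n → ℕ
    flood c s zero = s
    flood c s (suc t) v = relax c (n ^ κ) (inbox (flood c s t) v) (flood c s t v)

    from-neighbour : ∀ {v u k} → (adj G v u ∧ (ident u ≡ᵇ k)) ≡ true → adj G v u ≡ true × ident u ≡ k
    from-neighbour {v} {u} {k} eq with adj G v u
    ... | true = refl , ≡ᵇ⇒≡ (ident u) k (Equivalence.from T-≡ eq)

    inbox-neighbour : ∀ g {v u} → adj G v u ≡ true → inbox g v (ident u) ≡ just (g u)
    inbox-neighbour g {v} {u} e = pick-unique (∈-allFin u)
      (cong₂ _∧_ e (Equivalence.to T-≡ (≡⇒≡ᵇ (ident u) (ident u) refl)))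
      λ {w} eq → ident-inj (proj₂ (from-neighbour {v} {w} eq))

    -- Together with `flood-attained`, this makes `flood c s t v` the minimum of `s w + k * c` over
    -- the walks of length `k ≤ t` from `v` to `w`.
    flood-≤ : ∀ c s {w v k} t → Walk G v w k → k ≤ t → flood c s t v ≤ s w + k * c
    flood-≤ c s zero here _ = ≤-reflexive (sym (+-identityʳ _))
    flood-≤ c s {v = v} (suc t) here k≤ =
      ≤-trans (relax-≤ c (n ^ κ) (inbox (flood c s t) v) _) (flood-≤ c s t here z≤n)
    flood-≤ c s {w} {v} {suc k} (suc t) (step {w = u} e p) (s≤s k≤t) =
      ≤-trans (relax-≤-msg c (n ^ κ) (inbox (flood c s t) v) _ (ident< u) (inbox-neighbour _ e))
        (≤-trans (+-monoˡ-≤ c (flood-≤ c s t p k≤t))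
                 (≤-reflexive (trans (+-assoc (s w) (k * c) c) (cong (s w +_) (+-comm (k * c) c)))))

    flood-attained : ∀ c s t v → ∃[ w ] ∃[ k ] (Walk G v w k × k ≤ t × flood c s t v ≡ s w + k * c)
    flood-attained c s zero v = v , 0 , here , z≤n , sym (+-identityʳ _)
    flood-attained c s (suc t) v
      with relax-sel c (n ^ κ) (inbox (flood c s t) v) (flood c s t v)
    ... | inj₁ same with flood-attained c s t v
    ...   | w , k , p , k≤t , eq = w , k , p , m≤n⇒m≤1+n k≤t , trans same eq
    flood-attained c s (suc t) v | inj₂ (j , m , sent , new) with pick-just (allFin n) sent
    ... | u , e , refl with flood-attained c s t u
    ...   | w , k , p , k≤t , eq = w , suc k , step (proj₁ (from-neighbour {v} {u} e)) p , s≤s k≤t ,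
      trans new (trans (cong (_+ c) eq) (trans (+-assoc (s w) (k * c) c) (cong (s w +_) (+-comm (k * c) c))))

    module Stage {t₀} {past : Fin n → List ℕ} (c : ℕ)
                 (started : ∀ v → run t₀ v ≡ start (info-of v) (past v))
                 (uniform : ∀ v → cost n (past v) ≡ c) where

      seeds deadlines : Fin n → ℕ
      seeds v = seed (info-of v) (past v)
      deadlines v = deadline (info-of v) (past v)

      result : Fin n → ℕ
      result v = flood c seeds (suc f′ ⊓ deadlines v) v

      snapshot : ℕ → ℕ → Fin n → Node
      snapshot t r v = mkNode (info-of v) (past v) r
        (flood c seeds t v) (deadlines v ∸ t) (flood c seeds (t ⊓ deadlines v) v)

      relaxed-flood : ∀ t {r} → (∀ u → run (t + t₀) u ≡ snapshot t r u) →
                      ∀ v → run (suc t + t₀) v ≡ advance (snapshot t r v) (flood c seeds (suc t) v)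
      relaxed-flood t {r} eq v rewrite eq v | uniform v = cong (advance _)
        (relax-cong c (n ^ κ) (λ k → pick-cong (allFin n) λ u → cong value (eq u)) (flood c seeds t v))

      during : ∀ t {r} → t + r ≡ f′ → ∀ v → run (t + t₀) v ≡ snapshot t r v
      during zero refl v = started v
      during (suc t) {r} eq v = trans (relaxed-flood t (during t (trans (+-suc t r) eq)) v)
        (cong₂ (mkNode (info-of v) (past v) r (flood c seeds (suc t) v))
               (pred[m∸n]≡m∸[1+n] (deadlines v) t) (latch-⊓ (λ i → flood c seeds i v) t (deadlines v)))

      -- Has the form of `started`, so that stages can be chained.
      finished : ∀ v → run (suc f′ + t₀) v ≡ start (info-of v) (result v ∷ past v)
      finished v = trans (relaxed-flood f′ (during f′ (+-identityʳ f′)) v)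
        (cong (λ y → start (info-of v) (y ∷ past v)) (latch-⊓ (λ i → flood c seeds i v) f′ (deadlines v)))

      result-≤ : ∀ {v w k} → Walk G v w k → k ≤ suc f′ → k ≤ deadlines v → result v ≤ seeds w + k * c
      result-≤ p k≤f k≤deadline = flood-≤ c seeds _ p (⊓-glb k≤f k≤deadline)

      result-attained : ∀ v → ∃[ w ] ∃[ k ]
        (Walk G v w k × k ≤ suc f′ × k ≤ deadlines v × result v ≡ seeds w + k * c)
      result-attained v with flood-attained c seeds (suc f′ ⊓ deadlines v) v
      ... | w , k , p , k≤ , eq =
        w , k , p , ≤-trans k≤ (m⊓n≤m (suc f′) _) , ≤-trans k≤ (m⊓n≤n (suc f′) _) , eq

    module Bounded (B : ℕ) (seed≤ : ∀ v {past} → All (_≤ B) past → seed (info-of v) past ≤ B) where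

      record Good (v : Fin n) (s : Node) : Set where
        constructor good
        field
          info≡ : info s ≡ info-of v
          past≤ : All (_≤ B) (past s)
          value≤ : value s ≤ B
          reading≤ : reading s ≤ B

      start-good : ∀ v {past} → All (_≤ B) past → Good v (start (info-of v) past)
      start-good v past≤ = good refl past≤ (seed≤ v past≤) (seed≤ v past≤)

      latch-≤ : ∀ w {y x} → y ≤ B → x ≤ B → latch w y x ≤ B
      latch-≤ zero y≤ x≤ = y≤
      latch-≤ (suc _) y≤ x≤ = x≤

      advance-good : ∀ {v} s {x} → Good v s → x ≤ B → Good v (advance s x)
      advance-good {v} (mkNode _ _ zero _ w _) (good refl past≤ _ y≤) x≤ =
        start-good v (latch-≤ w y≤ x≤ ∷ past≤)
      advance-good (mkNode _ _ (suc _) _ w _) (good refl past≤ _ y≤) x≤ =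
        good refl past≤ x≤ (latch-≤ w y≤ x≤)

      -- An update never exceeds the old value, so a bound on the seeds survives any cost added to
      -- messages.
      run-good : ∀ t v → Good v (run t v)
      run-good zero v = start-good v []
      run-good (suc t) v with run t v | run-good t v
      ... | s | g = advance-good s g (≤-trans (relax-≤ _ (size (info s) ^ κ) _ _) (Good.value≤ g))

-- The ruling set protocol.

distance : Label → ℕ
distance nothing = 0
distance (just (_ , d)) = d

-- Lists of readings have the latest first.  If n ≤ f, all nodes are within distance f of each other
-- and the member of S is the node of smallest ID, found in stage 1.  If n > f:
--   stage 1 leaves a value above f exactly at the nodes v such that each labelled node w at distance
--   k ≤ f from v has distS(w) ≤ k; the faulty ones among them are the candidates;
--   stage 2 lets each labelled w learn the smallest ID of a candidate within distance distS(w), as it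
--   stops reading after distS(w) rounds; the value 0 reports a labelled member of S;
--   stage 3 takes this back to the faulty nodes.
-- Identifiers are shifted by one to leave 0 free, and infinity exceeds them all.
module Protocol (κ f : ℕ) where

  infinity : Info → ℕ
  infinity i = suc (size i ^ κ)

  cost : ℕ → List ℕ → ℕ
  cost n [] = if does (n ≤? f) then 0 else 1
  cost n (_ ∷ _) = 0

  -- For `k ≤ f`, the offer `suc f ∸ d + k` of a labelled node exceeds `f` exactly when `d ≤ k`;
  -- that of a faulty node always does.
  reach : Label → ℕ
  reach nothing = suc f
  reach (just (_ , d)) = suc f ∸ d

  seed : Info → List ℕ → ℕ
  seed (mkInfo n self l) [] = if does (n ≤? f) then self else reach l
  seed i@(mkInfo _ self nothing) (r₁ ∷ []) = if does (f <? r₁) then suc self else infinity i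
  seed i@(mkInfo _ _ (just (b , _))) (_ ∷ []) = if b then 0 else infinity i
  seed i@(mkInfo _ _ nothing) (_ ∷ _ ∷ _) = infinity i
  seed (mkInfo _ _ (just _)) (r₂ ∷ _ ∷ _) = r₂

  deadline : Info → List ℕ → ℕ
  deadline _ [] = f
  deadline _ (_ ∷ _ ∷ _) = f
  deadline (mkInfo _ _ nothing) (_ ∷ []) = f
  deadline (mkInfo _ _ (just (_ , d))) (_ ∷ []) = d

  verdict : Info → List ℕ → Bool
  verdict (mkInfo _ _ (just (b , _))) _ = b
  verdict (mkInfo n self nothing) (r₃ ∷ _ ∷ r₁ ∷ _) =
    -- Since `r₃` carries shifted IDs, `self < r₃` still holds when the node hears only itself.
    if does (n ≤? f) then does (self ≤? r₁) else does ((f <? r₁) ×-dec (self <? r₃))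
  verdict _ _ = false

-- Correctness of the protocol.

does≡ : ∀ {P : Set} {b} (P? : Dec P) → (P → b ≡ true) → (b ≡ true → P) → does P? ≡ b
does≡ {b = true} P? _ from = dec-true P? (from refl)
does≡ {b = false} P? to _ = dec-false P? λ p → contradiction (to p) λ ()

if-≤ : ∀ {x y z} b → x ≤ z → y ≤ z → (if b then x else y) ≤ z
if-≤ true x≤z _ = x≤z
if-≤ false _ y≤z = y≤z

module Correctness
  (κ f′ : ℕ) {n : ℕ} (G : Graph n) (ident : Fin n → ℕ)
  (ident-inj : Injective _≡_ _≡_ ident) (ident< : ∀ v → ident v < n ^ κ) (connected : Connected G)
  (S : Fin n → Bool) (greedy : IsGreedyRulingSet (suc f′) G ident S)
  (F : Subset n) (∣F∣≤f : ∣ F ∣ ≤ suc f′) (ζ : Fin n → Label)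
  (unlabelled : ∀ v → v ∈ F → ζ v ≡ nothing)
  (labelled : ∀ v → v ∉ F → ∃[ d ] (ζ v ≡ just (S v , d) × IsDistToSet G S v d))
  where

  f : ℕ
  f = suc f′

  open Protocol κ f
  open Staged κ f′ cost seed deadline verdict hiding (module Run)
  open Staged.Run κ f′ cost seed deadline verdict G ident ζ ident-inj ident<
  open Walks G
  open GreedyFaults f G ident ident-inj S greedy

  ℓ : Fin n → ℕ
  ℓ v = distance (ζ v)

  label-correct : ∀ {v} → v ∉ F → ζ v ≡ just (S v , ℓ v)
  label-correct {v} v∉F with labelled v v∉F
  ... | d , eq , _ rewrite eq = refl

  ℓ-dist : ∀ {v} → v ∉ F → IsDistToSet G S v (ℓ v)
  ℓ-dist {v} v∉F with labelled v v∉F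
  ... | d , eq , dist rewrite eq = dist

  open Labels F ∣F∣≤f ℓ ℓ-dist

  module Stage₁ = Stage {0} {λ _ → []} (cost n []) (λ _ → refl) (λ _ → refl)
  -- The start times are written as `3 * f` unfolds, so `Stage₃.finished` applies to the final round
  -- directly.
  module Stage₂ = Stage {f + 0} {λ v → Stage₁.result v ∷ []} 0 Stage₁.finished (λ _ → refl)
  module Stage₃ =
    Stage {f + (f + 0)} {λ v → Stage₂.result v ∷ Stage₁.result v ∷ []} 0 Stage₂.finished (λ _ → refl)

  r₁ r₂ r₃ : Fin n → ℕ
  r₁ = Stage₁.result
  r₂ = Stage₂.result
  r₃ = Stage₃.result

  outcome : Fin n → Bool
  outcome v = verdict (info-of v) (r₃ v ∷ r₂ v ∷ r₁ v ∷ [])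

  output≡outcome : ∀ v → output algorithm (run (3 * f) v) ≡ outcome v
  output≡outcome v rewrite Stage₃.finished v = refl

  outcome-labelled : ∀ {v} → v ∉ F → outcome v ≡ S v
  outcome-labelled v∉F rewrite label-correct v∉F = refl

  outcome-faulty : ∀ {v b} → v ∈ F → does (n ≤? f) ≡ b → outcome v ≡
    (if b then does (ident v ≤? r₁ v) else does ((f <? r₁ v) ×-dec (ident v <? r₃ v)))
  outcome-faulty {v} v∈F small = trans
    (cong (λ l → verdict (mkInfo n (ident v) l) (r₃ v ∷ r₂ v ∷ r₁ v ∷ [])) (unlabelled v v∈F))
    (cong (λ b → if b then does (ident v ≤? r₁ v) else does ((f <? r₁ v) ×-dec (ident v <? r₃ v))) small)

  module Small (n≤f : n ≤ f) where

    -- A shortest walk has distinct nodes, hence fewer than `n` steps.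
    close : ∀ u v → ∃[ k ] (k ≤ f × Walk G u v k)
    close u v with shortest (proj₂ (connected u v))
    ... | k , _ , p , geo = k , ≤-trans (n≤1+n k) (≤-trans 1+k≤n n≤f) , p
      where
      1+k≤n : suc k ≤ n
      1+k≤n = subst (suc k ≤_) (∣⊤∣≡n n) (shortest-within p geo ⊤ ≤-refl λ _ → ∈⊤)

    seed₁ : ∀ v → Stage₁.seeds v ≡ ident v
    seed₁ v rewrite dec-true (n ≤? f) n≤f = refl

    cost₁ : cost n [] ≡ 0
    cost₁ rewrite dec-true (n ≤? f) n≤f = refl

    value₁ : ∀ w k → Stage₁.seeds w + k * cost n [] ≡ ident w
    value₁ w k = trans (cong₂ _+_ (seed₁ w) (trans (cong (k *_) cost₁) (*-zeroʳ k))) (+-identityʳ _)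

    minimal⇒member : ∀ {v} → (∀ w → ident v ≤ ident w) → S v ≡ true
    minimal⇒member {v} min = Equivalence.from (greedy v) λ (w , _ , w<v , _) → <⇒≱ w<v (min w)

    r₁-≤ : ∀ v w → r₁ v ≤ ident w
    r₁-≤ v w with close v w
    ... | k , k≤f , p = ≤-trans (Stage₁.result-≤ p k≤f k≤f) (≤-reflexive (value₁ w k))

    -- The node `w` whose ID is read has the smallest ID, so it is in `S`, and close enough to `v`
    -- to coincide with it.
    accept : ∀ {v} → S v ≡ true → ident v ≤ r₁ v
    accept {v} Sv with Stage₁.result-attained v
    ... | w , k , p , k≤f , _ , eq = ≤-reflexive (trans (cong ident v≡w) (sym r₁≡))
      where
      r₁≡ : r₁ v ≡ ident w
      r₁≡ = trans eq (value₁ w k)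

      v≡w : v ≡ w
      v≡w = separated Sv (minimal⇒member λ x → subst (_≤ ident x) r₁≡ (r₁-≤ v x)) p
              (m≤n⇒m≤1+n (≤-trans k≤f (m≤m+n f _)))

    outcome-correct : ∀ {v} → v ∈ F → outcome v ≡ S v
    outcome-correct {v} v∈F = trans (outcome-faulty v∈F (dec-true (n ≤? f) n≤f))
      (does≡ (ident v ≤? r₁ v) (λ le → minimal⇒member λ w → ≤-trans le (r₁-≤ v w)) accept)

  module Large (n≰f : ¬ n ≤ f) where

    seed₁ : ∀ v → Stage₁.seeds v ≡ reach (ζ v)
    seed₁ v rewrite dec-false (n ≤? f) n≰f = refl

    cost₁ : cost n [] ≡ 1
    cost₁ rewrite dec-false (n ≤? f) n≰f = refl

    value₁ : ∀ w k → Stage₁.seeds w + k * cost n [] ≡ reach (ζ w) + k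
    value₁ w k = cong₂ _+_ (seed₁ w) (trans (cong (k *_) cost₁) (*-identityʳ k))

    reach-label : ∀ {w} → w ∉ F → reach (ζ w) ≡ suc f ∸ ℓ w
    reach-label w∉F rewrite label-correct w∉F = refl

    r₁⇒candidate : ∀ {v} → f < r₁ v → Candidate v
    r₁⇒candidate {v} f<r₁ {w} {k} w∉F p k≤f = ≮⇒≥ λ k<ℓw → <⇒≱ f<r₁ (begin
      r₁ v                  ≤⟨ Stage₁.result-≤ p k≤f k≤f ⟩
      Stage₁.seeds w + k * cost n []  ≡⟨ trans (value₁ w k) (cong (_+ k) (reach-label w∉F)) ⟩
      suc f ∸ ℓ w + k       ≤⟨ +-monoˡ-≤ k (∸-monoʳ-≤ (suc f) k<ℓw) ⟩
      f ∸ k + k             ≡⟨ m∸n+n≡m k≤f ⟩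
      f                     ∎)
      where open ≤-Reasoning

    candidate⇒r₁ : ∀ {v} → Candidate v → f < r₁ v
    candidate⇒r₁ {v} cand with Stage₁.result-attained v
    ... | w , k , p , k≤f , _ , eq rewrite trans eq (value₁ w k) with w ∈? F
    ...   | yes w∈F rewrite unlabelled w w∈F = m≤m+n (suc f) k
    ...   | no w∉F rewrite reach-label w∉F =
      ≤-trans (m≤n+m∸n (suc f) (ℓ w))
        (≤-trans (+-monoˡ-≤ _ (cand w∉F p k≤f)) (≤-reflexive (+-comm k _)))

    deadline₂ : ∀ {v} → v ∉ F → Stage₂.deadlines v ≡ ℓ v
    deadline₂ {v} v∉F = cong (λ l → deadline (mkInfo n (ident v) l) (r₁ v ∷ [])) (label-correct v∉F)

    seed₃-faulty : ∀ {v} → v ∈ F → Stage₃.seeds v ≡ suc (n ^ κ)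
    seed₃-faulty {v} v∈F =
      cong (λ l → seed (mkInfo n (ident v) l) (r₂ v ∷ r₁ v ∷ [])) (unlabelled v v∈F)

    seed₃-healthy : ∀ {v} → v ∉ F → Stage₃.seeds v ≡ r₂ v
    seed₃-healthy {v} v∉F =
      cong (λ l → seed (mkInfo n (ident v) l) (r₂ v ∷ r₁ v ∷ [])) (label-correct v∉F)

    seed₂-faulty : ∀ {v b} → v ∈ F → does (f <? r₁ v) ≡ b →
                   Stage₂.seeds v ≡ (if b then suc (ident v) else suc (n ^ κ))
    seed₂-faulty {v} v∈F eq = trans
      (cong (λ l → seed (mkInfo n (ident v) l) (r₁ v ∷ [])) (unlabelled v v∈F))
      (cong (λ b → if b then suc (ident v) else suc (n ^ κ)) eq)

    seed₂-healthy : ∀ {v b} → v ∉ F → S v ≡ b → Stage₂.seeds v ≡ (if b then 0 else suc (n ^ κ))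
    seed₂-healthy {v} v∉F refl =
      cong (λ l → seed (mkInfo n (ident v) l) (r₁ v ∷ [])) (label-correct v∉F)

    -- Cases for the node whose seed a reading of stage 2 attains, for use in `r₂-lower`.
    data Nominee (v : Fin n) : Set where
      elected   : v ∉ F → S v ≡ true → Nominee v
      candidate : v ∈ F → Candidate v → Stage₂.seeds v ≡ suc (ident v) → Nominee v
      outsider  : Stage₂.seeds v ≡ suc (n ^ κ) → Nominee v

    nominee : ∀ v → Nominee v
    nominee v with v ∈? F
    ... | no v∉F with S v in Sv
    ...   | true = elected v∉F Sv
    ...   | false = outsider (seed₂-healthy v∉F Sv)
    nominee v | yes v∈F with f <? r₁ v
    ...   | yes f<r₁ = candidate v∈F (r₁⇒candidate f<r₁) (seed₂-faulty v∈F (dec-true (f <? r₁ v) f<r₁))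
    ...   | no f≮r₁ = outsider (seed₂-faulty v∈F (dec-false (f <? r₁ v) f≮r₁))

    seed₂-member : ∀ {v} → v ∈ F → S v ≡ true → Stage₂.seeds v ≡ suc (ident v)
    seed₂-member {v} v∈F Sv =
      seed₂-faulty v∈F (dec-true (f <? r₁ v) (candidate⇒r₁ (member⇒candidate Sv)))

    no-cost : ∀ x k → x + k * 0 ≡ x
    no-cost x k = trans (cong (x +_) (*-zeroʳ k)) (+-identityʳ x)

    -- As `n > f`, some node is not faulty. On a shortest walk to it, the nodes before the first
    -- non-faulty one are distinct and faulty, hence at most `f`.
    healthy-nearby : ∀ v → ∃[ w ] ∃[ k ] (w ∉ F × k ≤ f × Walk G v w k)
    healthy-nearby v with any? (λ w → ¬? (w ∈? F))
    ... | no all-faulty = contradiction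
      (subst (_≤ f) (∣⊤∣≡n n) (≤-trans (p⊆q⇒∣p∣≤∣q∣ {p = ⊤} {F} λ {w} _ →
        decidable-stable (w ∈? F) λ w∉F → all-faulty (w , w∉F)) ∣F∣≤f)) n≰f
    ... | yes (w , w∉F) with shortest (proj₂ (connected v w))
    ...   | d , _ , p , geo
      with least (λ j → ¬? (at p j ∈? F)) d (λ d∈F → w∉F (subst (_∈ F) (at-end p) d∈F))
    ...     | j , j≤d , j∉F , before = at p j , j , j∉F ,
      ≤-trans (shortest-within p geo F (m≤n⇒m≤1+n j≤d) λ i<j → decidable-stable (_ ∈? F) (before i<j)) ∣F∣≤f ,
      prefix p j≤d

    -- A non-faulty `w` nearby hears its closest member `s` just by its deadline `ℓ w`. What `s`
    -- sends is 0 or, by `conflict`, a shifted ID of at most `ident v`.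
    reject : ∀ {v} → v ∈ F → S v ≢ true → Candidate v → r₃ v ≤ ident v
    reject {v} v∈F ¬Sv cand with healthy-nearby v
    ... | w , k , w∉F , k≤f , p with ℓ-dist w∉F
    ...   | (s , Ss , q) , _ = begin
      r₃ v                    ≤⟨ Stage₃.result-≤ p k≤f k≤f ⟩
      Stage₃.seeds w + k * 0  ≡⟨ trans (no-cost _ k) (seed₃-healthy w∉F) ⟩
      r₂ w                    ≤⟨ Stage₂.result-≤ q (≤-trans (cand w∉F p k≤f) k≤f)
                                                   (≤-reflexive (sym (deadline₂ w∉F))) ⟩
      Stage₂.seeds s + ℓ w * 0  ≡⟨ no-cost _ (ℓ w) ⟩
      Stage₂.seeds s          ≤⟨ seed₂-s ⟩
      ident v                 ∎
      where
      open ≤-Reasoning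

      seed₂-s : Stage₂.seeds s ≤ ident v
      seed₂-s with s ∈? F
      ... | no s∉F = ≤-trans (≤-reflexive (seed₂-healthy s∉F Ss)) z≤n
      ... | yes s∈F = ≤-trans (≤-reflexive (seed₂-member s∈F Ss))
        (conflict Ss s∈F v∈F cand (λ { refl → ¬Sv Ss }) w∉F p k≤f q)

    -- A labelled member heard by `w` would be too close to `v`; any other candidate heard has a
    -- larger ID by `conflict`, with `v` as its faulty member `s`.
    r₂-lower : ∀ {v w k} → v ∈ F → S v ≡ true → w ∉ F → Walk G v w k → k ≤ f → ident v < r₂ w
    r₂-lower {v} {w} {k} v∈F Sv w∉F p k≤f with Stage₂.result-attained w
    ... | x , j , q , j≤f , j≤deadline , eq
      rewrite trans eq (no-cost _ j) with nominee x
    ...   | elected x∉F Sx =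
      contradiction (subst (_∈ F) (separated Sv Sx (p ◅◅ q) (+-within k≤f j≤f)) v∈F) x∉F
    ...   | outsider eq′ rewrite eq′ = m<n⇒m<1+n (ident< v)
    ...   | candidate x∈F cand eq′ rewrite eq′ with v Fin.≟ x
    ...     | yes refl = ≤-refl
    ...     | no v≢x = m<n⇒m<1+n (conflict Sv v∈F x∈F cand v≢x w∉F (reverse q) j≤f w⇝v)
      where
      -- The closest member to `w` is at most `k` away from it, hence at most `2 * k` from `v`, and
      -- so equals `v`.
      w⇝v : Walk G w v (ℓ w)
      w⇝v with ℓ-dist w∉F
      ... | (s , Ss , r) , closest = subst (λ z → Walk G w z (ℓ w))
        (sym (separated Sv Ss (p ◅◅ r) (+-within k≤f (≤-trans (closest v k Sv (reverse p)) k≤f)))) r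

    accept : ∀ {v} → v ∈ F → S v ≡ true → ident v < r₃ v
    accept {v} v∈F Sv with Stage₃.result-attained v
    ... | w , k , p , k≤f , _ , eq rewrite trans eq (no-cost _ k) with w ∈? F
    ...   | yes w∈F = ≤-trans (m<n⇒m<1+n (ident< v)) (≤-reflexive (sym (seed₃-faulty w∈F)))
    ...   | no w∉F = ≤-trans (r₂-lower v∈F Sv w∉F p k≤f) (≤-reflexive (sym (seed₃-healthy w∉F)))

    outcome-correct : ∀ {v} → v ∈ F → outcome v ≡ S v
    outcome-correct {v} v∈F = trans (outcome-faulty v∈F (dec-false (n ≤? f) n≰f))
      (does≡ ((f <? r₁ v) ×-dec (ident v <? r₃ v))
        (λ (f<r₁ , v<r₃) → decidable-stable (S v Bool.≟ true)
          λ ¬Sv → <⇒≱ v<r₃ (reject v∈F ¬Sv (r₁⇒candidate f<r₁)))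
        (λ Sv → candidate⇒r₁ (member⇒candidate Sv) , accept v∈F Sv))

  outcome-correct : ∀ v → outcome v ≡ S v
  outcome-correct v with v ∈? F | n ≤? f
  ... | no v∉F | _ = outcome-labelled v∉F
  ... | yes v∈F | yes n≤f = Small.outcome-correct n≤f v∈F
  ... | yes v∈F | no n≰f = Large.outcome-correct n≰f v∈F

  -- `n` covers the hop-based seeds of stage 1, the rest covers shifted IDs and `infinity`.
  B : ℕ
  B = n + suc (n ^ κ)

  ident≤B : ∀ v → suc (ident v) ≤ B
  ident≤B v = ≤-trans (m<n⇒m<1+n (ident< v)) (m≤n+m _ n)

  seed≤B : ∀ v {past} → All (_≤ B) past → seed (info-of v) past ≤ B
  seed≤B v {[]} _ with n ≤? f
  ... | yes n≤f = ≤-trans (≤-reflexive (Small.seed₁ n≤f v)) (<⇒≤ (ident≤B v))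
  -- Here `suc f ≤ n`, which turns the bound on `reach` into one independent of `f`.
  ... | no n≰f = ≤-trans (≤-reflexive (Large.seed₁ n≰f v))
                   (≤-trans (reach≤ (ζ v)) (≤-trans (≰⇒> n≰f) (m≤m+n n _)))
    where
    reach≤ : ∀ l → reach l ≤ suc f
    reach≤ nothing = ≤-refl
    reach≤ (just (_ , d)) = m∸n≤m (suc f) d
  seed≤B v {r ∷ []} _ with ζ v
  ... | just (b , _) = if-≤ b z≤n (m≤n+m _ n)
  ... | nothing = if-≤ (does (f <? r)) (ident≤B v) (m≤n+m _ n)
  seed≤B v {r₂ ∷ _ ∷ _} (r₂≤ ∷ _) with ζ v
  ... | nothing = m≤n+m _ n
  ... | just _ = r₂≤

  value≤B : ∀ t v → send algorithm (run t v) (ident v) ≤ B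
  value≤B t v = Bounded.Good.value≤ (Bounded.run-good B seed≤B t v)

-- Message size and round count.

n<2^[1+⌊log₂n⌋] : ∀ n → n < 2 ^ suc ⌊log₂ n ⌋
n<2^[1+⌊log₂n⌋] n = ≰⇒> λ le →
  1+n≰n (subst (_≤ ⌊log₂ n ⌋) (⌊log₂[2^n]⌋≡n (suc ⌊log₂ n ⌋)) (⌊log₂⌋-mono-≤ le))

-- With `X > n` a power of two, three summands of at most `X * X ^ κ` are absorbed by two more
-- factors `X ≥ 2`, which explains the exponent `3 + κ`.
fits : ∀ κ n → n + suc (n ^ κ) < 2 ^ congestBits (3 + κ) n
fits κ n = begin-strict
  n + suc (n ^ κ)          <⟨ +-mono-<-≤ (n<2^[1+⌊log₂n⌋] n) (s≤s (^-monoˡ-≤ κ (<⇒≤ (n<2^[1+⌊log₂n⌋] n)))) ⟩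
  X + suc (X ^ κ)          ≤⟨ +-mono-≤ (m≤m*n X (X ^ κ)) (+-mono-≤ 1≤XY (m≤n*m (X ^ κ) X)) ⟩
  XY + (XY + XY)           ≤⟨ +-monoʳ-≤ XY (+-monoʳ-≤ XY (m≤m+n XY (XY + 0))) ⟩
  4 * XY                   ≤⟨ *-monoˡ-≤ XY (*-mono-≤ 2≤X 2≤X) ⟩
  X * X * XY               ≡⟨ *-assoc X X XY ⟩
  X ^ (3 + κ)              ≡⟨ ^-*-assoc 2 L (3 + κ) ⟩
  2 ^ (L * (3 + κ))        ≡⟨ cong (2 ^_) (*-comm L (3 + κ)) ⟩
  2 ^ congestBits (3 + κ) n ∎
  where
  open ≤-Reasoning
  L X XY : ℕ
  L = suc ⌊log₂ n ⌋
  X = 2 ^ L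
  XY = X * X ^ κ
  2≤X : 2 ≤ X
  2≤X = m≤m*n 2 (2 ^ ⌊log₂ n ⌋) {{m^n≢0 2 ⌊log₂ n ⌋}}
  instance
    X≢0 : NonZero X
    X≢0 = m^n≢0 2 L
    X^κ≢0 : NonZero (X ^ κ)
    X^κ≢0 = m^n≢0 X κ
  1≤XY : 1 ≤ XY
  1≤XY = *-mono-≤ (≤-trans (s≤s z≤n) 2≤X) (>-nonZero⁻¹ (X ^ κ))

theorem4 : (κ : ℕ) → ∃[ C ] ((f : ℕ) → 1 ≤ f → Σ Algorithm λ A →
    rounds A ≤ C * f ×
    ((n : ℕ) (G : Graph n) (ident : Fin n → ℕ) →
    Injective _≡_ _≡_ ident → (∀ v → ident v < n ^ κ) →
    Connected G →
    (S : Fin n → Bool) → IsGreedyRulingSet f G ident S →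
    (F : Subset n) → ∣ F ∣ ≤ f →
    (ζ : Fin n → Label) →
    (∀ v → v ∈ F → ζ v ≡ nothing) →
    (∀ v → v ∉ F → ∃[ d ] (ζ v ≡ just (S v , d) × IsDistToSet G S v d)) →
    Bandwidth A G ident ζ (congestBits C n) ×
    (∀ v → output A (exec A G ident ζ (rounds A) v) ≡ S v)))
-- One constant serves both purposes: `3` stages of `f` rounds, and the exponent in `fits`.
theorem4 κ = 3 + κ , λ { (suc f′) _ →
  let open Protocol κ (suc f′) in
  Staged.algorithm κ f′ cost seed deadline verdict , *-monoˡ-≤ (suc f′) (m≤m+n 3 κ) ,
  λ n G ident inj ident< connected S greedy F ∣F∣≤f ζ unlabelled labelled →
  let open Correctness κ f′ G ident inj ident< connected S greedy F ∣F∣≤f ζ unlabelled labelled in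
  (λ t u v _ _ → ≤-<-trans (value≤B t u) (fits κ n)) ,
  (λ v → trans (output≡outcome v) (outcome-correct v)) }
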